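{- Let $G=(V,E)$ be a finite simple undirected graph of maximum degree at most $3$, let $M^*$ be a maximum matching of $G$, and let $M$ be the matching output by any run of the \textsc{1-2-MinGreedy} algorithm on $G$. Then $|M|\geq \frac{2}{3}|M^*|$.
   Context: The (deterministic) \textsc{1-2-MinGreedy} algorithm starts with $M=\emptyset$ and repeats until no edges remain in the current graph (initially $G$): if every node has current degree at least $3$, it selects an arbitrary edge $\{u,v\}$; otherwise it selects an arbitrary node $u$ of minimum non-zero current degree and an arbitrary neighbor $v$ of $u$. It then adds $\{u,v\}$ to $M$ and removes all edges incident with $u$ or $v$ from the current graph. All arbitrary choices may be made adversarially; the claim holds for every run. (Every run of the deterministic \textsc{MinGreedy} algorithm, which always selects a node of minimum non-zero current degree and an arbitrary neighbor, is also a run of \textsc{1-2-MinGreedy}.) -}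

module Defs where

open import Data.Nat.Base using (ℕ; _≤_; _<_)
open import Data.Fin.Base using (Fin)
open import Data.Fin.Properties using (_≟_)
open import Data.List.Base using (List; []; _∷_; length; filter; allFin)
open import Data.List.Relation.Unary.All using (All)
open import Data.List.Relation.Unary.AllPairs using (AllPairs)
open import Data.Product.Base using (_×_; _,_; ∃-syntax; uncurry)
open import Level using (0ℓ)
open import Relation.Binary.Core using (Rel)
open import Relation.Binary.Definitions using (Decidable; Symmetric)
open import Relation.Binary.Construct.Closure.ReflexiveTransitive using (Star)
open import Relation.Binary.PropositionalEquality.Core using (_≢_)
open import Relation.Nullary.Decidable.Core using (_×-dec_; ¬?)
open import Relation.Nullary.Negation.Core using (¬_)

record Graph (n : ℕ) : Set₁ where
  field
    Adj    : Rel (Fin n) 0ℓ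
    adj?   : Decidable Adj
    symm   : Symmetric Adj
    irrefl : ∀ v → ¬ Adj v v

open Graph public

degree : ∀ {n} → Graph n → Fin n → ℕ
degree {n} G u = length (filter (adj? G u) (allFin n))

Edgeless : ∀ {n} → Graph n → Set
Edgeless G = ∀ u v → ¬ Adj G u v

-- An edge is represented by either of the two ordered pairs of its endpoints.
Disjoint : ∀ {n} → Rel (Fin n × Fin n) 0ℓ
Disjoint (u , v) (x , y) = (u ≢ x × u ≢ y) × (v ≢ x × v ≢ y)

disjoint? : ∀ {n} → Decidable (Disjoint {n})
disjoint? (u , v) (x , y) =
  (¬? (u ≟ x) ×-dec ¬? (u ≟ y)) ×-dec (¬? (v ≟ x) ×-dec ¬? (v ≟ y))

-- Pairwise disjointness rules out listing an edge twice, in either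
-- orientation, so the cardinality of a matching is the length of the list.
record IsMatching {n} (G : Graph n) (M : List (Fin n × Fin n)) : Set where
  field
    edges    : All (uncurry (Adj G)) M
    disjoint : AllPairs Disjoint M

record IsMaximumMatching {n} (G : Graph n) (M : List (Fin n × Fin n)) : Set where
  field
    isMatching : IsMatching G M
    maximum    : ∀ M′ → IsMatching G M′ → length M′ ≤ length M

-- Vertices are kept, so u and v become isolated.
removeIncident : ∀ {n} → Graph n → Fin n → Fin n → Graph n
removeIncident G u v = record
  { Adj    = λ x y → Adj G x y × Disjoint (x , y) (u , v)
  ; adj?   = λ x y → adj? G x y ×-dec disjoint? (x , y) (u , v)
  ; symm   = λ (xy , x≢ , y≢) → symm G xy , y≢ , x≢
  ; irrefl = λ x (xx , _) → irrefl G x xx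
  }

-- Matched vertices stay in the current graph with degree 0, so "every node has
-- degree at least 3" has to be read as a condition on non-isolated nodes.
AllDegrees≥3 : ∀ {n} → Graph n → Set
AllDegrees≥3 G = ∀ w → 0 < degree G w → 3 ≤ degree G w

record HasMinNonZeroDegree {n} (G : Graph n) (u : Fin n) : Set where
  field
    nonZero : 0 < degree G u
    minimal : ∀ w → 0 < degree G w → degree G u ≤ degree G w

data Selects {n} (G : Graph n) (u v : Fin n) : Set where
  arbitraryEdge : AllDegrees≥3 G → Adj G u v → Selects G u v
  minDegreeNode : ¬ AllDegrees≥3 G → HasMinNonZeroDegree G u → Adj G u v →
                  Selects G u v

State : ℕ → Set₁
State n = Graph n × List (Fin n × Fin n)

data Step {n} : State n → State n → Set₁ where
  step : ∀ {G M u v} → Selects G u v →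
         Step (G , M) (removeIncident G u v , (u , v) ∷ M)

1-2-MinGreedyOutputs : ∀ {n} → Graph n → List (Fin n × Fin n) → Set₁
1-2-MinGreedyOutputs G M = ∃[ H ] Star Step (G , []) (H , M) × Edgeless H

{-# OPTIONS --safe #-}
-- Follow the surviving part N of M* in the current graph by a potential.  A
-- vertex covered by N weighs 2, an uncovered vertex of degree d weighs min(2, d),
-- and the state earns a bonus of 1 if it has leaves, all of them uncovered.  The
-- potential is at least 4|M*| initially and 0 finally, so 4|M*| ≤ 6|M| once no
-- step lowers it by more than 6.  Every selected u has minimum degree.
-- If deg u = 3, the other vertices lose at most 1 per common neighbour of u and v.
-- If deg u = 2, they lose at most 1 per removed edge, so the total loss is at
-- most 4 + 3, and if it is 7 then the step creates leaves, all uncovered, and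
-- the bonus makes up for the excess.  If deg u = 1, a loss of 6 is never exceeded,
-- and after a bonus the weights lose at most 5, since the vertex uncovered by
-- matching v is not a leaf.
module Submission where

open import Defs
open import Data.Nat.Base using (ℕ) renaming (_≤_ to _≤ℕ_)
open import Data.Integer.Base using (+_)
open import Data.Rational.Base using (_/_; _*_; _≥_)
open import Data.Fin.Base using (Fin)
open import Data.List.Base using (List; length)
open import Data.Product.Base using (_×_)

open import Algebra.Properties.CommutativeMonoid.Sum
  using (sum; sum-cong-≗; sum-replicate-zero; ∑-distrib-+)
open import Data.Bool.Base using (if_then_else_)
open import Data.Fin.Base using (zero; suc)
open import Data.Fin.Properties using (_≟_; any?; all?)
import Data.Integer.Base as ℤ
import Data.Integer.Properties as ℤ
open import Data.List.Base using ([]; _∷_; filter; tabulate)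
open import Data.List.Relation.Unary.All as All using (All; []; _∷_)
open import Data.List.Relation.Unary.AllPairs using ([]; _∷_)
open import Data.Nat.Base using (zero; suc; _+_; _<_; _⊓_; z≤n; s≤s; s≤s⁻¹)
  renaming (_*_ to _*ℕ_)
import Data.Nat.Properties as ℕ
open import Data.Product.Base using (_,_; proj₁; proj₂; ∃-syntax)
open import Data.Rational.Base using (toℚᵘ)
import Data.Rational.Properties as ℚ
open import Data.Rational.Unnormalised.Base as ℚᵘ using (mkℚᵘ)
import Data.Rational.Unnormalised.Properties as ℚᵘ
open import Data.Sum.Base using (_⊎_; inj₁; inj₂)
open import Function.Base using (_∘_)
open import Function.Bundles using (mk⇔)
open import Relation.Binary.Construct.Closure.ReflexiveTransitive using (Star; ε; _◅_)
open import Relation.Binary.PropositionalEquality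
open import Relation.Nullary.Decidable
  using (Dec; yes; no; does; dec-true; dec-false; does-⇔; decidable-stable; _×-dec_; _→-dec_; ¬?)
open import Relation.Nullary.Negation using (¬_; contradiction)
open import Relation.Unary using (Pred; Decidable)

-- Finite sums, indicators, and position relative to an edge

Σ[_] : ∀ {n} → (Fin n → ℕ) → ℕ
Σ[ f ] = sum ℕ.+-0-commutativeMonoid f

𝟙 : ∀ {a} {A : Set a} → Dec A → ℕ
𝟙 a? = if does a? then 1 else 0

𝟙-true : ∀ {a} {A : Set a} (a? : Dec A) → A → 𝟙 a? ≡ 1
𝟙-true a? a rewrite dec-true a? a = refl

𝟙-false : ∀ {a} {A : Set a} (a? : Dec A) → ¬ A → 𝟙 a? ≡ 0
𝟙-false a? ¬a rewrite dec-false a? ¬a = refl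

𝟙≤1 : ∀ {a} {A : Set a} (a? : Dec A) → 𝟙 a? ≤ℕ 1
𝟙≤1 (yes _) = ℕ.≤-refl
𝟙≤1 (no _)  = z≤n

δ : ∀ {n} → Fin n → Fin n → ℕ
δ x y = 𝟙 (x ≟ y)

δ-refl : ∀ {n} (x : Fin n) → δ x x ≡ 1
δ-refl x = 𝟙-true (x ≟ x) refl

δ-≢ : ∀ {n} {x y : Fin n} → x ≢ y → δ x y ≡ 0
δ-≢ = 𝟙-false (_ ≟ _)

Σ-mono-≤ : ∀ {n} {f g : Fin n → ℕ} → (∀ x → f x ≤ℕ g x) → Σ[ f ] ≤ℕ Σ[ g ]
Σ-mono-≤ {zero}  f≤g = z≤n
Σ-mono-≤ {suc n} f≤g = ℕ.+-mono-≤ (f≤g zero) (Σ-mono-≤ (f≤g ∘ suc))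

Σ-mono-< : ∀ {n} {f g : Fin n → ℕ} → (∀ x → f x ≤ℕ g x) →
           ∀ x → f x < g x → Σ[ f ] < Σ[ g ]
Σ-mono-< f≤g zero    f<g = ℕ.+-mono-<-≤ f<g (Σ-mono-≤ (f≤g ∘ suc))
Σ-mono-< f≤g (suc x) f<g = ℕ.+-mono-≤-< (f≤g zero) (Σ-mono-< (f≤g ∘ suc) x f<g)

Σ-<⇒∃< : ∀ {n} {f g : Fin n → ℕ} → Σ[ f ] < Σ[ g ] → ∃[ x ] f x < g x
Σ-<⇒∃< {f = f} {g} Σf<Σg with any? (λ x → f x ℕ.<? g x)
... | yes ∃< = ∃<
... | no ¬∃< = contradiction Σf<Σg
                 (ℕ.≤⇒≯ (Σ-mono-≤ (λ x → ℕ.≮⇒≥ (λ f<g → ¬∃< (x , f<g)))))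

Σ-+ : ∀ {n} (f g : Fin n → ℕ) → Σ[ (λ x → f x + g x) ] ≡ Σ[ f ] + Σ[ g ]
Σ-+ = ∑-distrib-+ ℕ.+-0-commutativeMonoid

Σ-cong : ∀ {n} {f g : Fin n → ℕ} → f ≗ g → Σ[ f ] ≡ Σ[ g ]
Σ-cong = sum-cong-≗ ℕ.+-0-commutativeMonoid

Σ-zero : ∀ n → Σ[ (λ (_ : Fin n) → 0) ] ≡ 0
Σ-zero = sum-replicate-zero ℕ.+-0-commutativeMonoid

Σ-δ* : ∀ {n} (x : Fin n) (f : Fin n → ℕ) → Σ[ (λ y → δ x y *ℕ f y) ] ≡ f x
Σ-δ* {suc n} zero f =
  trans (cong₂ _+_ (ℕ.*-identityˡ (f zero)) (Σ-zero n)) (ℕ.+-identityʳ (f zero))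
Σ-δ* (suc x) f = Σ-δ* x (f ∘ suc)

Σ-δ : ∀ {n} (x : Fin n) → Σ[ δ x ] ≡ 1
Σ-δ x = trans (Σ-cong (λ y → sym (ℕ.*-identityʳ (δ x y)))) (Σ-δ* x (λ _ → 1))

data Position {n} (u v x : Fin n) : Set where
  first   : x ≡ u → Position u v x
  second  : x ≡ v → Position u v x
  neither : x ≢ u → x ≢ v → Position u v x

position : ∀ {n} (u v x : Fin n) → Position u v x
position u v x with x ≟ u | x ≟ v
... | yes x≡u | _       = first x≡u
... | no _    | yes x≡v = second x≡v
... | no x≢u  | no x≢v  = neither x≢u x≢v

-- Degrees as sums, and their change under edge removal

edge : ∀ {n} → Graph n → Fin n → Fin n → ℕ
edge G x y = 𝟙 (adj? G x y)

module _ {n} (G : Graph n) where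

  edge-true : ∀ {x y} → Adj G x y → edge G x y ≡ 1
  edge-true = 𝟙-true (adj? G _ _)

  edge-false : ∀ {x y} → ¬ Adj G x y → edge G x y ≡ 0
  edge-false = 𝟙-false (adj? G _ _)

  edge-sym : ∀ x y → edge G x y ≡ edge G y x
  edge-sym x y = cong (if_then 1 else 0)
    (does-⇔ (mk⇔ (symm G) (symm G)) (adj? G x y) (adj? G y x))

  adj⇒≢ : ∀ {x y} → Adj G x y → x ≢ y
  adj⇒≢ xy refl = irrefl G _ xy

length-filter-tabulate : ∀ {a p} {A : Set a} {P : Pred A p} (P? : Decidable P)
  {n} (f : Fin n → A) → length (filter P? (tabulate f)) ≡ Σ[ (λ x → 𝟙 (P? (f x))) ]
length-filter-tabulate P? {zero}  f = refl
length-filter-tabulate P? {suc n} f with P? (f zero)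
... | yes _ = cong suc (length-filter-tabulate P? (f ∘ suc))
... | no _  = length-filter-tabulate P? (f ∘ suc)

module _ {n} (G : Graph n) where

  degree-Σ : ∀ x → degree G x ≡ Σ[ edge G x ]
  degree-Σ x = length-filter-tabulate (adj? G x) (λ y → y)

  adj⇒0<degree : ∀ {x y} → Adj G x y → 0 < degree G x
  adj⇒0<degree {x} {y} xy = begin
    1             ≡⟨ Σ-δ y ⟨
    Σ[ δ y ]      ≤⟨ Σ-mono-≤ δ≤edge ⟩
    Σ[ edge G x ] ≡⟨ degree-Σ x ⟨
    degree G x    ∎
    where
    open ℕ.≤-Reasoning
    δ≤edge : ∀ z → δ y z ≤ℕ edge G x z
    δ≤edge z with y ≟ z
    ... | yes refl = ℕ.≤-reflexive (sym (edge-true G xy))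
    ... | no _     = z≤n

  isolated⇒degree≡0 : ∀ {x} → (∀ y → ¬ Adj G x y) → degree G x ≡ 0
  isolated⇒degree≡0 {x} ¬xy =
    trans (degree-Σ x) (trans (Σ-cong (λ y → edge-false G (¬xy y))) (Σ-zero n))

  -- Two distinct neighbours would put two unit masses below an indicator of total 1.
  degree≡1⇒unique-neighbour : ∀ {x y z} → degree G x ≡ 1 → Adj G x y → Adj G x z → y ≡ z
  degree≡1⇒unique-neighbour {x} {y} {z} d≡1 xy xz with y ≟ z
  ... | yes y≡z = y≡z
  ... | no y≢z  = contradiction 2≤1 λ{ (s≤s ()) }
    where
    open ℕ.≤-Reasoning
    δδ≤edge : ∀ w → δ y w + δ z w ≤ℕ edge G x w
    δδ≤edge w with y ≟ w | z ≟ w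
    ... | yes refl | yes refl = contradiction refl y≢z
    ... | yes refl | no _     = ℕ.≤-reflexive (sym (edge-true G xy))
    ... | no _     | yes refl = ℕ.≤-reflexive (sym (edge-true G xz))
    ... | no _     | no _     = z≤n
    2≤1 : 2 ≤ℕ 1
    2≤1 = begin
      2                           ≡⟨ cong₂ _+_ (Σ-δ y) (Σ-δ z) ⟨
      Σ[ δ y ] + Σ[ δ z ]         ≡⟨ Σ-+ (δ y) (δ z) ⟨
      Σ[ (λ w → δ y w + δ z w) ]  ≤⟨ Σ-mono-≤ δδ≤edge ⟩
      Σ[ edge G x ]               ≡⟨ degree-Σ x ⟨
      degree G x                  ≡⟨ d≡1 ⟩
      1                           ∎

module _ {n} (G : Graph n) {u v : Fin n} (u≢v : u ≢ v) where

  private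
    G′ = removeIncident G u v

  removed-u : degree G′ u ≡ 0
  removed-u = isolated⇒degree≡0 G′ (λ _ uy → proj₁ (proj₁ (proj₂ uy)) refl)

  removed-v : degree G′ v ≡ 0
  removed-v = isolated⇒degree≡0 G′ (λ _ vy → proj₂ (proj₁ (proj₂ vy)) refl)

  -- An edge at `x` either survives or ends in exactly one of `u` and `v`, as these are distinct and
  -- `x` is neither of them.
  degree-removeIncident : ∀ {x} → x ≢ u → x ≢ v →
    degree G x ≡ degree G′ x + (edge G u x + edge G v x)
  degree-removeIncident {x} x≢u x≢v = begin
    degree G x
      ≡⟨ degree-Σ G x ⟩
    Σ[ edge G x ]
      ≡⟨ Σ-cong split ⟩
    Σ[ (λ y → edge G′ x y + (at u y + at v y)) ]
      ≡⟨ Σ-+ (edge G′ x) _ ⟩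
    Σ[ edge G′ x ] + Σ[ (λ y → at u y + at v y) ]
      ≡⟨ cong₂ _+_ (sym (degree-Σ G′ x)) (Σ-+ (at u) (at v)) ⟩
    degree G′ x + (Σ[ at u ] + Σ[ at v ])
      ≡⟨ cong (_+_ (degree G′ x)) (cong₂ _+_ (Σ-at u) (Σ-at v)) ⟩
    degree G′ x + (edge G u x + edge G v x)
      ∎
    where
    open ≡-Reasoning
    at : Fin n → Fin n → ℕ
    at w y = δ w y *ℕ edge G x y
    Σ-at : ∀ w → Σ[ at w ] ≡ edge G w x
    Σ-at w = trans (Σ-δ* w (edge G x)) (edge-sym G x w)
    split : ∀ y → edge G x y ≡ edge G′ x y + (at u y + at v y)
    split y with u ≟ y | v ≟ y
    ... | yes refl | yes refl = contradiction refl u≢v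
    ... | yes refl | no _     = sym (cong₂ _+_
      (edge-false G′ {x} {u} (λ xu → proj₁ (proj₂ (proj₂ xu)) refl))
      (trans (ℕ.+-identityʳ _) (ℕ.*-identityˡ _)))
    ... | no _     | yes refl = sym (cong₂ _+_
      (edge-false G′ {x} {v} (λ xv → proj₂ (proj₂ (proj₂ xv)) refl)) (ℕ.*-identityˡ _))
    ... | no u≢y   | no v≢y   = trans (cong (if_then 1 else 0) (does-⇔
      (mk⇔ (λ xy → xy , (x≢u , x≢v) , (u≢y ∘ sym , v≢y ∘ sym)) proj₁) (adj? G x y) (adj? G′ x y)))
      (sym (ℕ.+-identityʳ _))

  degree-removeIncident-≤ : ∀ x → degree G′ x ≤ℕ degree G x
  degree-removeIncident-≤ x with position u v x
  ... | first refl      = ℕ.≤-trans (ℕ.≤-reflexive removed-u) z≤n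
  ... | second refl     = ℕ.≤-trans (ℕ.≤-reflexive removed-v) z≤n
  ... | neither x≢u x≢v =
    ℕ.≤-trans (ℕ.m≤m+n _ _) (ℕ.≤-reflexive (sym (degree-removeIncident x≢u x≢v)))

-- Pairings, weights and the potential

-- A matching as an involution whose fixed points are the uncovered vertices.
record IsPairing {n} (G : Graph n) (μ : Fin n → Fin n) : Set where
  field
    involutive : ∀ x → μ (μ x) ≡ x
    adjacent   : ∀ {x} → μ x ≢ x → Adj G x (μ x)

weight : ∀ {n} → Graph n → (Fin n → Fin n) → Fin n → ℕ
weight G μ x = if does (μ x ≟ x) then 2 ⊓ degree G x else 2

-- The condition for the bonus. It forces the minimum non-zero degree to be 1, so a bonus can only
-- be given up at a step where `u` is a leaf.
Pendant : ∀ {n} → Graph n → (Fin n → Fin n) → Set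
Pendant G μ = (∃[ x ] degree G x ≡ 1) × (∀ x → degree G x ≡ 1 → μ x ≡ x)

pendant? : ∀ {n} (G : Graph n) μ → Dec (Pendant G μ)
pendant? G μ = any? (λ x → degree G x ℕ.≟ 1)
         ×-dec all? (λ x → (degree G x ℕ.≟ 1) →-dec (μ x ≟ x))

potential : ∀ {n} → Graph n → (Fin n → Fin n) → ℕ
potential G μ = Σ[ weight G μ ] + 𝟙 (pendant? G μ)

-- Truncation does not magnify a loss: removing `b` edges costs the truncated degree at most `b`.
2⊓-subadditive : ∀ a b → 2 ⊓ (a + b) ≤ℕ 2 ⊓ a + b
2⊓-subadditive zero          b = ℕ.m⊓n≤n 2 b
2⊓-subadditive (suc zero)    b = s≤s (ℕ.m⊓n≤n 1 b)
2⊓-subadditive (suc (suc a)) b = s≤s (s≤s z≤n)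

module _ {n} (G : Graph n) (μ : Fin n → Fin n) where

  weight-uncovered : ∀ {x} → μ x ≡ x → weight G μ x ≡ 2 ⊓ degree G x
  weight-uncovered {x} μx≡x rewrite dec-true (μ x ≟ x) μx≡x = refl

  weight-covered : ∀ {x} → μ x ≢ x → weight G μ x ≡ 2
  weight-covered {x} μx≢x rewrite dec-false (μ x ≟ x) μx≢x = refl

  weight≤2 : ∀ x → weight G μ x ≤ℕ 2
  weight≤2 x with μ x ≟ x
  ... | yes _ = ℕ.m⊓n≤m 2 _
  ... | no _  = ℕ.≤-refl

  2⊓degree≤weight : ∀ x → 2 ⊓ degree G x ≤ℕ weight G μ x
  2⊓degree≤weight x with μ x ≟ x
  ... | yes _ = ℕ.≤-refl
  ... | no _  = ℕ.m⊓n≤m 2 _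

  -- A covered vertex has a neighbour, hence degree at least 2 here, so its truncated degree already
  -- reaches 2. In the absence of leaves the weights therefore do not depend on the pairing.
  weight≤2⊓degree : IsPairing G μ → (∀ w → 0 < degree G w → 2 ≤ℕ degree G w) →
    ∀ x → weight G μ x ≤ℕ 2 ⊓ degree G x
  weight≤2⊓degree pairing 2≤degree x with μ x ≟ x
  ... | yes _   = ℕ.≤-refl
  ... | no μx≢x = ℕ.⊓-glb ℕ.≤-refl
    (2≤degree x (adj⇒0<degree G (IsPairing.adjacent pairing μx≢x)))

-- Restricting a pairing to the remaining graph

unmatch : ∀ {n} → (Fin n → Fin n) → Fin n → Fin n → Fin n → Fin n
unmatch μ u v x = if does (disjoint? (x , μ x) (u , v)) then μ x else x

module _ {n} (μ : Fin n → Fin n) (u v : Fin n) where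

  unmatch-disjoint : ∀ {x} → Disjoint (x , μ x) (u , v) → unmatch μ u v x ≡ μ x
  unmatch-disjoint {x} d rewrite dec-true (disjoint? (x , μ x) (u , v)) d = refl

  unmatch-¬disjoint : ∀ {x} → ¬ Disjoint (x , μ x) (u , v) → unmatch μ u v x ≡ x
  unmatch-¬disjoint {x} ¬d rewrite dec-false (disjoint? (x , μ x) (u , v)) ¬d = refl

  unmatch-cases : ∀ x → (Disjoint (x , μ x) (u , v) × unmatch μ u v x ≡ μ x)
                      ⊎ (¬ Disjoint (x , μ x) (u , v) × unmatch μ u v x ≡ x)
  unmatch-cases x = go (disjoint? (x , μ x) (u , v))
    where
    go : Dec (Disjoint (x , μ x) (u , v)) → _
    go (yes d) = inj₁ (d , unmatch-disjoint d)
    go (no ¬d) = inj₂ (¬d , unmatch-¬disjoint ¬d)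

  -- Meeting `u` or `v` is a property of the unordered pair, so by involutivity `x` and `μ x` are
  -- kept or released together.
  unmatch-pairing : ∀ {G : Graph n} → IsPairing G μ →
    IsPairing (removeIncident G u v) (unmatch μ u v)
  unmatch-pairing {G} pairing = record { involutive = inv ; adjacent = λ {x} → adj x }
    where
    open IsPairing pairing
    inv : ∀ x → unmatch μ u v (unmatch μ u v x) ≡ x
    inv x with unmatch-cases x
    ... | inj₂ (_ , eq) = trans (cong (unmatch μ u v) eq) eq
    ... | inj₁ ((x≢ , μx≢) , eq) = trans (cong (unmatch μ u v) eq) (trans
      (unmatch-disjoint (μx≢ , subst (λ y → y ≢ u × y ≢ v) (sym (involutive x)) x≢))
      (involutive x))
    adj : ∀ x → unmatch μ u v x ≢ x → Adj (removeIncident G u v) x (unmatch μ u v x)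
    adj x ≢x with unmatch-cases x
    ... | inj₂ (_ , eq) = contradiction eq ≢x
    ... | inj₁ (d , eq) = subst (Adj (removeIncident G u v) x) (sym eq)
      (adjacent (λ μx≡x → ≢x (trans eq μx≡x)) , d)

-- Loss of potential in one step, by the degree of `u`

module Greedy {n} (G : Graph n) (degree≤3 : ∀ x → degree G x ≤ℕ 3)
  {μ : Fin n → Fin n} (pairing : IsPairing G μ)
  {u v : Fin n} (uv : Adj G u v) (minimal : ∀ x → 0 < degree G x → degree G u ≤ℕ degree G x)
  where

  private
    open IsPairing pairing

    G′ : Graph n
    G′ = removeIncident G u v

    μ′ : Fin n → Fin n
    μ′ = unmatch μ u v

    u≢v : u ≢ v
    u≢v = adj⇒≢ G uv

    uv≡1 : edge G u v ≡ 1
    uv≡1 = edge-true G uv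

    vu≡1 : edge G v u ≡ 1
    vu≡1 = edge-true G (symm G uv)

    -- The estimate goes through degrees alone, so it also holds when `x` loses its partner.
    2⊓degree-drop : ∀ {x} → x ≢ u → x ≢ v → 2 ⊓ degree G x ≤ℕ
      weight G′ μ′ x + (edge G u x + edge G v x)
    2⊓degree-drop {x} x≢u x≢v = begin
      2 ⊓ degree G x
        ≡⟨ cong (2 ⊓_) (degree-removeIncident G u≢v x≢u x≢v) ⟩
      2 ⊓ (degree G′ x + (edge G u x + edge G v x))
        ≤⟨ 2⊓-subadditive (degree G′ x) _ ⟩
      2 ⊓ degree G′ x + (edge G u x + edge G v x)
        ≤⟨ ℕ.+-monoˡ-≤ _ (2⊓degree≤weight G′ μ′ x) ⟩
      weight G′ μ′ x + (edge G u x + edge G v x)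
        ∎
      where open ℕ.≤-Reasoning

    ¬pendant : 2 ≤ℕ degree G u → ¬ Pendant G μ
    ¬pendant 2≤du ((x , dx≡1) , _) = contradiction
      (ℕ.≤-trans 2≤du (ℕ.≤-trans (minimal x (ℕ.≤-reflexive (sym dx≡1))) (ℕ.≤-reflexive dx≡1)))
      λ{ (s≤s ()) }

    potential≡Σweight : 2 ≤ℕ degree G u → potential G μ ≡ Σ[ weight G μ ]
    potential≡Σweight 2≤du =
      trans (cong₂ _+_ refl (𝟙-false (pendant? G μ) (¬pendant 2≤du))) (ℕ.+-identityʳ _)

    Σweight≤potential : Σ[ weight G′ μ′ ] ≤ℕ potential G′ μ′
    Σweight≤potential = ℕ.m≤m+n _ _

  module MinDegree≥2 (2≤du : 2 ≤ℕ degree G u) where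

    -- Each of `u` and `v` may lose 2: the edge between them contributes 1 to both, and the `δ`
    -- terms supply the other 1. Every other vertex pays 1 per removed edge.
    loss : Fin n → ℕ
    loss x = (edge G u x + edge G v x) + (δ u x + δ v x)

    weight≤ : ∀ x → weight G μ x ≤ℕ 2 ⊓ degree G x
    weight≤ = weight≤2⊓degree G μ pairing (λ x 0<dx → ℕ.≤-trans 2≤du (minimal x 0<dx))

    weight-drop : ∀ x → weight G μ x ≤ℕ weight G′ μ′ x + loss x
    weight-drop x with position u v x
    ... | first refl rewrite vu≡1 | δ-refl u = begin
      weight G μ u                                     ≤⟨ weight≤2 G μ u ⟩
      1 + (1 + 0)                                      ≤⟨ ℕ.+-mono-≤ (ℕ.m≤n+m 1 (edge G u u)) (ℕ.+-monoʳ-≤ 1 z≤n) ⟩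
      (edge G u u + 1) + (1 + δ v u)                   ≤⟨ ℕ.m≤n+m _ (weight G′ μ′ u) ⟩
      weight G′ μ′ u + ((edge G u u + 1) + (1 + δ v u)) ∎
      where open ℕ.≤-Reasoning
    ... | second refl rewrite uv≡1 | δ-refl v = begin
      weight G μ v                                     ≤⟨ weight≤2 G μ v ⟩
      (1 + 0) + (0 + 1)                                ≤⟨ ℕ.+-mono-≤ {1 + 0} {1 + edge G v v} (ℕ.+-monoʳ-≤ 1 z≤n) (ℕ.m≤n+m 1 (δ u v)) ⟩
      (1 + edge G v v) + (δ u v + 1)                   ≤⟨ ℕ.m≤n+m _ (weight G′ μ′ v) ⟩
      weight G′ μ′ v + ((1 + edge G v v) + (δ u v + 1)) ∎
      where open ℕ.≤-Reasoning
    ... | neither x≢u x≢v = begin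
      weight G μ x                               ≤⟨ weight≤ x ⟩
      2 ⊓ degree G x                             ≤⟨ 2⊓degree-drop x≢u x≢v ⟩
      weight G′ μ′ x + (edge G u x + edge G v x) ≤⟨ ℕ.+-monoʳ-≤ (weight G′ μ′ x) (ℕ.m≤m+n _ _) ⟩
      weight G′ μ′ x + loss x                    ∎
      where open ℕ.≤-Reasoning

    Σ-loss : Σ[ (λ x → weight G′ μ′ x + loss x) ] ≡
             Σ[ weight G′ μ′ ] + ((degree G u + degree G v) + 2)
    Σ-loss = begin
      Σ[ (λ x → weight G′ μ′ x + loss x) ]
        ≡⟨ Σ-+ (weight G′ μ′) loss ⟩
      Σ[ weight G′ μ′ ] + Σ[ loss ]
        ≡⟨ cong (_+_ Σ[ weight G′ μ′ ]) (trans (Σ-+ (λ x → edge G u x + edge G v x) _)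
             (cong₂ _+_ (Σ-+ (edge G u) (edge G v)) (Σ-+ (δ u) (δ v)))) ⟩
      Σ[ weight G′ μ′ ] + ((Σ[ edge G u ] + Σ[ edge G v ]) + (Σ[ δ u ] + Σ[ δ v ]))
        ≡⟨ cong (_+_ Σ[ weight G′ μ′ ]) (cong₂ _+_
             (sym (cong₂ _+_ (degree-Σ G u) (degree-Σ G v))) (cong₂ _+_ (Σ-δ u) (Σ-δ v))) ⟩
      Σ[ weight G′ μ′ ] + ((degree G u + degree G v) + 2)
        ∎
      where open ≡-Reasoning

  module MinDegree≡2 (du≡2 : degree G u ≡ 2) where

    open MinDegree≥2 (ℕ.≤-reflexive (sym du≡2))

    -- Such an r keeps all but one of its edges, so it either becomes a leaf or
    -- does not lose the full amount.
    private-neighbour : degree G v ≡ 3 → ∃[ r ] r ≢ u × r ≢ v × Adj G v r × ¬ Adj G u r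
    -- The summands are the indicators of the closed neighbourhoods of `u` and `v`, of sizes 3 and
    -- 4. Both contain `u` and `v`, so an element of the second outside the first is neither of
    -- them.
    private-neighbour dv≡3 with Σ-<⇒∃< {f = λ x → edge G u x + δ u x} {λ x → edge G v x + δ v x} Σ<Σ
      where
      open ≡-Reasoning
      Σ-closed : ∀ w → Σ[ (λ x → edge G w x + δ w x) ] ≡ degree G w + 1
      Σ-closed w = trans (Σ-+ (edge G w) (δ w)) (cong₂ _+_ (sym (degree-Σ G w)) (Σ-δ w))
      Σ<Σ : Σ[ (λ x → edge G u x + δ u x) ] < Σ[ (λ x → edge G v x + δ v x) ]
      Σ<Σ = ℕ.≤-reflexive (begin
        suc Σ[ (λ x → edge G u x + δ u x) ] ≡⟨ cong suc (trans (Σ-closed u) (cong₂ _+_ du≡2 refl)) ⟩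
        4                                   ≡⟨ trans (Σ-closed v) (cong₂ _+_ dv≡3 refl) ⟨
        Σ[ (λ x → edge G v x + δ v x) ]     ∎)
    ... | r , <r with adj? G u r | adj? G v r | u ≟ r | v ≟ r
    ... | no ¬ur | yes vr | no u≢r   | no v≢r   = r , u≢r ∘ sym , v≢r ∘ sym , vr , ¬ur
    ... | no ¬ur | _      | _        | yes refl = contradiction uv ¬ur
    ... | no _   | no _   | _        | no _     = contradiction <r λ()
    ... | no _   | yes _  | yes refl | no _     = contradiction <r (ℕ.<-irrefl refl)
    ... | yes ur | yes vr | yes refl | _        = contradiction ur (irrefl G u)
    ... | yes ur | no _   | yes refl | _        = contradiction ur (irrefl G u)
    ... | yes _  | no _   | no _     | no _     = contradiction <r λ()
    ... | yes _  | yes _  | no _     | no _     = contradiction <r (ℕ.<-irrefl refl)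
    ... | yes _  | no _   | no _     | yes _    = contradiction <r (ℕ.<-irrefl refl)
    ... | yes _  | yes vr | no _     | yes refl = contradiction vr (irrefl G v)

    Σ-drop⇒potential-drop : Σ[ weight G μ ] ≤ℕ 6 + Σ[ weight G′ μ′ ] →
      potential G μ ≤ℕ 6 + potential G′ μ′
    Σ-drop⇒potential-drop Σ≤ = begin
      potential G μ             ≡⟨ potential≡Σweight (ℕ.≤-reflexive (sym du≡2)) ⟩
      Σ[ weight G μ ]           ≤⟨ Σ≤ ⟩
      6 + Σ[ weight G′ μ′ ]     ≤⟨ ℕ.+-monoʳ-≤ 6 Σweight≤potential ⟩
      6 + potential G′ μ′       ∎
      where open ℕ.≤-Reasoning

    -- The constant is 6 for `d` = 2, but 7, one too many, for `d` = 3.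
    Σ-loss≤ : ∀ {d} → degree G v ≤ℕ d →
      Σ[ (λ x → weight G′ μ′ x + loss x) ] ≤ℕ ((2 + d) + 2) + Σ[ weight G′ μ′ ]
    Σ-loss≤ {d} dv≤d = begin
      Σ[ (λ x → weight G′ μ′ x + loss x) ]
        ≡⟨ Σ-loss ⟩
      Σ[ weight G′ μ′ ] + ((degree G u + degree G v) + 2)
        ≤⟨ ℕ.+-monoʳ-≤ Σ[ weight G′ μ′ ] (ℕ.+-monoˡ-≤ 2
             (ℕ.+-mono-≤ (ℕ.≤-reflexive du≡2) dv≤d)) ⟩
      Σ[ weight G′ μ′ ] + ((2 + d) + 2)
        ≡⟨ ℕ.+-comm Σ[ weight G′ μ′ ] _ ⟩
      ((2 + d) + 2) + Σ[ weight G′ μ′ ]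
        ∎
      where open ℕ.≤-Reasoning

    -- A single vertex that loses less than its allowance lowers the bound from 7 to 6.
    potential-drop-strict : ∀ x → weight G μ x < weight G′ μ′ x + loss x →
      potential G μ ≤ℕ 6 + potential G′ μ′
    potential-drop-strict x w<w′ = Σ-drop⇒potential-drop
      (s≤s⁻¹ (ℕ.≤-trans (Σ-mono-< weight-drop x w<w′) (Σ-loss≤ (degree≤3 v))))

    -- Such a vertex had degree at least 2 and so is charged for a removed edge, yet being covered
    -- it still weighs the full 2.
    covered-leaf-strict : ∀ {x} → degree G′ x ≡ 1 → μ′ x ≢ x →
      weight G μ x < weight G′ μ′ x + loss x
    covered-leaf-strict {x} d′≡1 μ′x≢x = begin
      suc (weight G μ x)        ≤⟨ s≤s (weight≤2 G μ x) ⟩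
      2 + 1                     ≤⟨ ℕ.+-monoʳ-≤ 2 1≤edges ⟩
      2 + edges                 ≡⟨ cong (_+ edges) (weight-covered G′ μ′ μ′x≢x) ⟨
      weight G′ μ′ x + edges    ≤⟨ ℕ.+-monoʳ-≤ (weight G′ μ′ x) (ℕ.m≤m+n _ _) ⟩
      weight G′ μ′ x + loss x   ∎
      where
      open ℕ.≤-Reasoning
      edges : ℕ
      edges = edge G u x + edge G v x
      x≢u : x ≢ u
      x≢u refl = contradiction (trans (sym d′≡1) (removed-u G u≢v)) λ()
      x≢v : x ≢ v
      x≢v refl = contradiction (trans (sym d′≡1) (removed-v G u≢v)) λ()
      0<dx : 0 < degree G x
      0<dx = ℕ.≤-trans (ℕ.≤-reflexive (sym d′≡1)) (degree-removeIncident-≤ G u≢v x)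
      1≤edges : 1 ≤ℕ edges
      1≤edges = s≤s⁻¹ (begin
        2                    ≡⟨ du≡2 ⟨
        degree G u           ≤⟨ minimal x 0<dx ⟩
        degree G x           ≡⟨ degree-removeIncident G u≢v x≢u x≢v ⟩
        degree G′ x + edges  ≡⟨ cong (_+ edges) d′≡1 ⟩
        1 + edges            ∎)

    -- The surplus unit is recovered from a covered leaf of `G′`, or from `r` if `r` is no leaf, or
    -- else from the bonus of the new state.
    potential-drop-≡3 : degree G v ≡ 3 → potential G μ ≤ℕ 6 + potential G′ μ′
    potential-drop-≡3 dv≡3
      with any? (λ x → (degree G′ x ℕ.≟ 1) ×-dec ¬? (μ′ x ≟ x)) | private-neighbour dv≡3
    ... | yes (x , d′≡1 , μ′x≢x) | _ = potential-drop-strict x (covered-leaf-strict d′≡1 μ′x≢x)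
    ... | no ∄covered-leaf | r , r≢u , r≢v , vr , ¬ur = go (degree G′ r ℕ.≟ 1)
      where
      open ℕ.≤-Reasoning
      edges≡1 : edge G u r + edge G v r ≡ 1
      edges≡1 = cong₂ _+_ (edge-false G ¬ur) (edge-true G vr)
      1≤d′r : 1 ≤ℕ degree G′ r
      1≤d′r = s≤s⁻¹ (begin
        2                                      ≡⟨ du≡2 ⟨
        degree G u                             ≤⟨ minimal r (adj⇒0<degree G (symm G vr)) ⟩
        degree G r                             ≡⟨ degree-removeIncident G u≢v r≢u r≢v ⟩
        degree G′ r + (edge G u r + edge G v r) ≡⟨ cong (_+_ (degree G′ r)) edges≡1 ⟩
        degree G′ r + 1                        ≡⟨ ℕ.+-comm (degree G′ r) 1 ⟩
        1 + degree G′ r                        ∎)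
      go : Dec (degree G′ r ≡ 1) → potential G μ ≤ℕ 6 + potential G′ μ′
      -- Only the edge to `v` disappears at `r`, so `r` keeps degree at least 2 and weight 2
      -- although it is charged 1.
      go (no d′r≢1) = potential-drop-strict r (begin
        suc (weight G μ r)         ≤⟨ s≤s (weight≤2 G μ r) ⟩
        2 + 1                      ≤⟨ ℕ.+-monoˡ-≤ 1 (ℕ.⊓-glb ℕ.≤-refl
                                        (ℕ.≤∧≢⇒< 1≤d′r (d′r≢1 ∘ sym))) ⟩
        2 ⊓ degree G′ r + 1        ≤⟨ ℕ.+-mono-≤ (2⊓degree≤weight G′ μ′ r)
                                        (ℕ.≤-reflexive (sym edges≡1)) ⟩
        weight G′ μ′ r + (edge G u r + edge G v r)
                                   ≤⟨ ℕ.+-monoʳ-≤ (weight G′ μ′ r) (ℕ.m≤m+n _ _) ⟩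
        weight G′ μ′ r + loss r    ∎)
      -- Now `r` is a leaf and no leaf is covered, so the seventh unit reappears as the bonus.
      go (yes d′r≡1) = begin
        potential G μ                            ≡⟨ potential≡Σweight (ℕ.≤-reflexive (sym du≡2)) ⟩
        Σ[ weight G μ ]                          ≤⟨ Σ-mono-≤ weight-drop ⟩
        Σ[ (λ x → weight G′ μ′ x + loss x) ]     ≤⟨ Σ-loss≤ (degree≤3 v) ⟩
        6 + (1 + Σ[ weight G′ μ′ ])              ≡⟨ cong (_+_ 6) (ℕ.+-comm 1 Σ[ weight G′ μ′ ]) ⟩
        6 + (Σ[ weight G′ μ′ ] + 1)              ≡⟨ cong (λ k → 6 + (Σ[ weight G′ μ′ ] + k))
                                                      (𝟙-true (pendant? G′ μ′) pendant) ⟨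
        6 + potential G′ μ′                      ∎
        where
        pendant : Pendant G′ μ′
        pendant = (r , d′r≡1) , λ x d′x≡1 →
          decidable-stable (μ′ x ≟ x) (λ μ′x≢x → ∄covered-leaf (x , d′x≡1 , μ′x≢x))

    potential-drop : potential G μ ≤ℕ 6 + potential G′ μ′
    potential-drop with degree G v ℕ.≟ 3
    ... | yes dv≡3 = potential-drop-≡3 dv≡3
    ... | no dv≢3  = Σ-drop⇒potential-drop (ℕ.≤-trans (Σ-mono-≤ weight-drop)
                       (Σ-loss≤ (s≤s⁻¹ (ℕ.≤∧≢⇒< (degree≤3 v) dv≢3))))

  module MinDegree≡3 (du≡3 : degree G u ≡ 3) where

    private
      2≤du : 2 ≤ℕ degree G u
      2≤du = ℕ.≤-trans (ℕ.n≤1+n 2) (ℕ.≤-reflexive (sym du≡3))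

    open MinDegree≥2 2≤du using (weight≤)

    -- Here `a` and `b` count the edges to `u` and to `v`. Degree 3 exceeds the cap 2 by one, so the
    -- edge to `v` is removed free of charge.
    cubic-drop : ∀ d a b → b ≤ℕ 1 → 3 ≤ℕ d + (a + b) → 2 ≤ℕ 2 ⊓ d + a
    cubic-drop d a b b≤1 3≤ = begin
      2           ≤⟨ ℕ.⊓-glb ℕ.≤-refl (s≤s⁻¹ 3≤1+d+a) ⟩
      2 ⊓ (d + a) ≤⟨ 2⊓-subadditive d a ⟩
      2 ⊓ d + a   ∎
      where
      open ℕ.≤-Reasoning
      3≤1+d+a : 3 ≤ℕ 1 + (d + a)
      3≤1+d+a = begin
        3           ≤⟨ 3≤ ⟩
        d + (a + b) ≡⟨ ℕ.+-assoc d a b ⟨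
        (d + a) + b ≤⟨ ℕ.+-monoʳ-≤ (d + a) b≤1 ⟩
        (d + a) + 1 ≡⟨ ℕ.+-comm (d + a) 1 ⟩
        1 + (d + a) ∎

    -- All neighbours of `u` are charged, not only the common ones: this costs `degree G u` = 3 and
    -- includes one unit for `v`. Two units for `u` and a second one for `v` bring the total to 6.
    loss : Fin n → ℕ
    loss x = edge G u x + (δ u x + (δ u x + δ v x))

    weight-drop : ∀ x → weight G μ x ≤ℕ weight G′ μ′ x + loss x
    weight-drop x with position u v x
    ... | first refl rewrite δ-refl u = begin
      weight G μ u                                     ≤⟨ weight≤2 G μ u ⟩
      1 + (1 + 0)                                      ≤⟨ ℕ.+-monoʳ-≤ 1 (ℕ.+-monoʳ-≤ 1 z≤n) ⟩
      1 + (1 + δ v u)                                  ≤⟨ ℕ.m≤n+m _ (edge G u u) ⟩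
      edge G u u + (1 + (1 + δ v u))                   ≤⟨ ℕ.m≤n+m _ (weight G′ μ′ u) ⟩
      weight G′ μ′ u + (edge G u u + (1 + (1 + δ v u))) ∎
      where open ℕ.≤-Reasoning
    ... | second refl rewrite uv≡1 | δ-refl v | δ-≢ u≢v =
      ℕ.≤-trans (weight≤2 G μ v) (ℕ.m≤n+m 2 (weight G′ μ′ v))
    ... | neither x≢u x≢v = ℕ.≤-trans (go (0 ℕ.<? degree G x))
            (ℕ.+-monoʳ-≤ (weight G′ μ′ x) (ℕ.m≤m+n _ _))
      where
      open ℕ.≤-Reasoning
      go : Dec (0 < degree G x) → weight G μ x ≤ℕ weight G′ μ′ x + edge G u x
      -- An isolated vertex has nothing to lose: `weight≤` bounds its weight by its degree 0.
      go (no ¬0<dx) = begin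
        weight G μ x    ≤⟨ weight≤ x ⟩
        2 ⊓ degree G x  ≤⟨ ℕ.m⊓n≤n 2 _ ⟩
        degree G x      ≤⟨ ℕ.≮⇒≥ ¬0<dx ⟩
        0               ≤⟨ z≤n ⟩
        weight G′ μ′ x + edge G u x ∎
      go (yes 0<dx) = begin
        weight G μ x                 ≤⟨ weight≤2 G μ x ⟩
        2                            ≤⟨ cubic-drop (degree G′ x) (edge G u x) (edge G v x)
                                          (𝟙≤1 (adj? G v x)) 3≤ ⟩
        2 ⊓ degree G′ x + edge G u x ≤⟨ ℕ.+-monoˡ-≤ _ (2⊓degree≤weight G′ μ′ x) ⟩
        weight G′ μ′ x + edge G u x  ∎
        where
        3≤ : 3 ≤ℕ degree G′ x + (edge G u x + edge G v x)
        3≤ = begin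
          3          ≡⟨ du≡3 ⟨
          degree G u ≤⟨ minimal x 0<dx ⟩
          degree G x ≡⟨ degree-removeIncident G u≢v x≢u x≢v ⟩
          degree G′ x + (edge G u x + edge G v x) ∎

    Σ-loss : Σ[ loss ] ≡ 6
    Σ-loss = trans (Σ-+ (edge G u) _) (cong₂ _+_ (trans (sym (degree-Σ G u)) du≡3)
      (trans (Σ-+ (δ u) _) (cong₂ _+_ (Σ-δ u)
        (trans (Σ-+ (δ u) (δ v)) (cong₂ _+_ (Σ-δ u) (Σ-δ v))))))

    potential-drop : potential G μ ≤ℕ 6 + potential G′ μ′
    potential-drop = begin
      potential G μ                        ≡⟨ potential≡Σweight 2≤du ⟩
      Σ[ weight G μ ]                      ≤⟨ Σ-mono-≤ weight-drop ⟩
      Σ[ (λ x → weight G′ μ′ x + loss x) ] ≡⟨ Σ-+ (weight G′ μ′) loss ⟩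
      Σ[ weight G′ μ′ ] + Σ[ loss ]        ≡⟨ cong (_+_ Σ[ weight G′ μ′ ]) Σ-loss ⟩
      Σ[ weight G′ μ′ ] + 6                ≡⟨ ℕ.+-comm _ 6 ⟩
      6 + Σ[ weight G′ μ′ ]                ≤⟨ ℕ.+-monoʳ-≤ 6 Σweight≤potential ⟩
      6 + potential G′ μ′                  ∎
      where open ℕ.≤-Reasoning

  module MinDegree≡1 (du≡1 : degree G u ≡ 1) where

    ¬edge-u : ∀ {x} → x ≢ v → edge G u x ≡ 0
    ¬edge-u x≢v =
      edge-false G (λ ux → x≢v (degree≡1⇒unique-neighbour G du≡1 ux uv))

    -- A covered vertex whose pair survives keeps weight 2; an uncovered one pays for its removed
    -- edges.
    weight-drop-kept : ∀ {x} → x ≢ u → x ≢ v → Disjoint (x , μ x) (u , v) →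
      weight G μ x ≤ℕ weight G′ μ′ x + (edge G u x + edge G v x)
    weight-drop-kept {x} x≢u x≢v d = go (μ x ≟ x)
      where
      go : Dec (μ x ≡ x) → _
      go (yes μx≡x) = ℕ.≤-trans (ℕ.≤-reflexive (weight-uncovered G μ μx≡x))
                        (2⊓degree-drop x≢u x≢v)
      go (no μx≢x)  = ℕ.≤-trans (weight≤2 G μ x) (ℕ.≤-trans
        (ℕ.≤-reflexive (sym (weight-covered G′ μ′ (μx≢x ∘ trans (sym (unmatch-disjoint μ u v d))))))
        (ℕ.m≤m+n _ _))

    -- The vertex μ v may lose 2 although only one of its edges is removed;
    -- extra absorbs the surplus.
    module _ (extra : Fin n → ℕ)
      (at-u : weight G μ u ≤ℕ 1 + extra u)
      (at-new : ∀ {x} → x ≢ u → x ≢ v → μ x ≡ v → Adj G v x →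
                weight G μ x ≤ℕ weight G′ μ′ x + (1 + extra x))
      where

      -- The doubled `δ v` pays for `v`. The edge from `v` pays one unit for each neighbour,
      -- including `u`; whatever `u` or `μ v` loses beyond that falls to `extra`.
      loss : Fin n → ℕ
      loss x = (edge G v x + extra x) + (δ v x + δ v x)

      weight-drop : ∀ x → weight G μ x ≤ℕ weight G′ μ′ x + loss x
      weight-drop x with position u v x
      ... | first refl rewrite vu≡1 =
        ℕ.≤-trans at-u (ℕ.≤-trans (ℕ.m≤m+n (1 + extra u) _) (ℕ.m≤n+m _ (weight G′ μ′ u)))
      ... | second refl rewrite δ-refl v =
        ℕ.≤-trans (weight≤2 G μ v)
          (ℕ.≤-trans (ℕ.m≤n+m 2 (edge G v v + extra v)) (ℕ.m≤n+m _ (weight G′ μ′ v)))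
      ... | neither x≢u x≢v = ℕ.≤-trans (go (position u v (μ x)))
              (ℕ.+-monoʳ-≤ (weight G′ μ′ x) (ℕ.m≤m+n _ _))
        where
        open ℕ.≤-Reasoning
        go : Position u v (μ x) → weight G μ x ≤ℕ weight G′ μ′ x + (edge G v x + extra x)
        -- The only possible partner of the leaf `u` is `v`, which `x` is not.
        go (first μx≡u) = contradiction
          (degree≡1⇒unique-neighbour G du≡1 (symm G (subst (Adj G x) μx≡u
            (adjacent (λ μx≡x → x≢u (trans (sym μx≡x) μx≡u))))) uv) x≢v
        go (second μx≡v) = subst (λ k → weight G μ x ≤ℕ weight G′ μ′ x + (k + extra x))
          (sym (edge-true G vx)) (at-new x≢u x≢v μx≡v vx)
          where
          vx : Adj G v x
          vx = symm G (subst (Adj G x) μx≡v (adjacent (λ μx≡x → x≢v (trans (sym μx≡x) μx≡v))))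
        go (neither μx≢u μx≢v) = begin
          weight G μ x
            ≤⟨ weight-drop-kept x≢u x≢v ((x≢u , x≢v) , (μx≢u , μx≢v)) ⟩
          weight G′ μ′ x + (edge G u x + edge G v x)
            ≡⟨ cong (λ k → weight G′ μ′ x + (k + edge G v x)) (¬edge-u x≢v) ⟩
          weight G′ μ′ x + edge G v x
            ≤⟨ ℕ.+-monoʳ-≤ (weight G′ μ′ x) (ℕ.m≤m+n _ _) ⟩
          weight G′ μ′ x + (edge G v x + extra x)
            ∎

      Σ-loss≤ : Σ[ loss ] ≤ℕ 5 + Σ[ extra ]
      Σ-loss≤ = begin
        Σ[ loss ]
          ≡⟨ trans (Σ-+ (λ x → edge G v x + extra x) _)
               (cong₂ _+_ (Σ-+ (edge G v) extra) (Σ-+ (δ v) (δ v))) ⟩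
        (Σ[ edge G v ] + Σ[ extra ]) + (Σ[ δ v ] + Σ[ δ v ])
          ≡⟨ cong₂ _+_ (cong (_+ Σ[ extra ]) (sym (degree-Σ G v))) (cong₂ _+_ (Σ-δ v) (Σ-δ v)) ⟩
        (degree G v + Σ[ extra ]) + 2
          ≤⟨ ℕ.+-monoˡ-≤ 2 (ℕ.+-monoˡ-≤ Σ[ extra ] (degree≤3 v)) ⟩
        (3 + Σ[ extra ]) + 2
          ≡⟨ ℕ.+-comm _ 2 ⟩
        5 + Σ[ extra ]
          ∎
        where open ℕ.≤-Reasoning

      -- The basic loss is at most 5, from `degree G v` ≤ 3 and the 2 at `v`. This leaves one unit,
      -- to be spent either on `extra` or on a bonus of the old state that may vanish.
      potential-drop-extra : Σ[ extra ] + 𝟙 (pendant? G μ) ≤ℕ 1 →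
        potential G μ ≤ℕ 6 + potential G′ μ′
      potential-drop-extra extra≤1 = begin
        Σ[ weight G μ ] + p                         ≤⟨ ℕ.+-monoˡ-≤ p (Σ-mono-≤ weight-drop) ⟩
        Σ[ (λ x → weight G′ μ′ x + loss x) ] + p    ≡⟨ cong (_+ p) (Σ-+ (weight G′ μ′) loss) ⟩
        (Σ[ weight G′ μ′ ] + Σ[ loss ]) + p         ≤⟨ ℕ.+-monoˡ-≤ p (ℕ.+-mono-≤ Σweight≤potential Σ-loss≤) ⟩
        (potential G′ μ′ + (5 + Σ[ extra ])) + p    ≡⟨ ℕ.+-assoc (potential G′ μ′) _ p ⟩
        potential G′ μ′ + (5 + (Σ[ extra ] + p))    ≤⟨ ℕ.+-monoʳ-≤ (potential G′ μ′) (ℕ.+-monoʳ-≤ 5 extra≤1) ⟩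
        potential G′ μ′ + 6                         ≡⟨ ℕ.+-comm (potential G′ μ′) 6 ⟩
        6 + potential G′ μ′                         ∎
        where
        open ℕ.≤-Reasoning
        p : ℕ
        p = 𝟙 (pendant? G μ)

    potential-drop : potential G μ ≤ℕ 6 + potential G′ μ′
    potential-drop = go (μ u ≟ u) (pendant? G μ)
      where
      open ℕ.≤-Reasoning
      weight-u≤1 : μ u ≡ u → weight G μ u ≤ℕ 1
      weight-u≤1 μu≡u =
        ℕ.≤-reflexive (trans (weight-uncovered G μ μu≡u) (cong (2 ⊓_) du≡1))
      go : Dec (μ u ≡ u) → Dec (Pendant G μ) → potential G μ ≤ℕ 6 + potential G′ μ′
      -- With `u` matched to `v`, no third vertex loses its partner, and the covered leaf `u` rules
      -- out a bonus. The spare unit pays for the second unit of weight at `u`.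
      go (no μu≢u) _ = potential-drop-extra (δ u)
        (ℕ.≤-trans (weight≤2 G μ u) (ℕ.≤-reflexive (cong suc (sym (δ-refl u)))))
        (λ x≢u _ μx≡v _ → contradiction
          (trans (sym (involutive _)) (trans (cong μ (trans μx≡v (sym μu≡v))) (involutive u))) x≢u)
        (ℕ.≤-reflexive (cong₂ _+_ (Σ-δ u)
          (𝟙-false (pendant? G μ) (λ (_ , uncovered) → μu≢u (uncovered u du≡1)))))
        where
        μu≡v : μ u ≡ v
        μu≡v = degree≡1⇒unique-neighbour G du≡1 (adjacent μu≢u) uv
      -- The uncovered leaf `u` weighs only 1 and there is no bonus to lose, so the spare unit goes
      -- to the vertex released by `v`.
      go (yes μu≡u) (no ¬p) = potential-drop-extra (δ (μ v))
        (ℕ.≤-trans (weight-u≤1 μu≡u) (ℕ.m≤m+n 1 _))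
        (λ {x} _ _ μx≡v _ → begin
          weight G μ x                           ≤⟨ weight≤2 G μ x ⟩
          2                                      ≡⟨ cong suc (trans (cong (λ y → δ y x)
                                                      (trans (cong μ (sym μx≡v)) (involutive x))) (δ-refl x)) ⟨
          1 + δ (μ v) x                          ≤⟨ ℕ.m≤n+m _ (weight G′ μ′ x) ⟩
          weight G′ μ′ x + (1 + δ (μ v) x)       ∎)
        (ℕ.≤-reflexive (cong₂ _+_ (Σ-δ (μ v)) (𝟙-false (pendant? G μ) ¬p)))
      -- The spare unit is reserved for the bonus. All leaves are uncovered, so the partner `x` of
      -- `v` has degree at least 2; losing its edge to `v` lowers its weight by at most 1.
      go (yes μu≡u) (yes (_ , uncovered)) = potential-drop-extra (λ _ → 0)
        (weight-u≤1 μu≡u)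
        (λ {x} x≢u x≢v μx≡v vx → begin
          weight G μ x
            ≤⟨ weight≤2 G μ x ⟩
          2
            ≤⟨ ℕ.⊓-glb ℕ.≤-refl (ℕ.≤∧≢⇒< (adj⇒0<degree G (symm G vx))
                 (λ 1≡dx → x≢v (trans (sym (uncovered x (sym 1≡dx))) μx≡v))) ⟩
          2 ⊓ degree G x
            ≤⟨ 2⊓degree-drop x≢u x≢v ⟩
          weight G′ μ′ x + (edge G u x + edge G v x)
            ≡⟨ cong (_+_ (weight G′ μ′ x)) (cong₂ _+_ (¬edge-u x≢v) (edge-true G vx)) ⟩
          weight G′ μ′ x + 1
            ∎)
        (ℕ.≤-trans (ℕ.≤-reflexive (cong (_+ 𝟙 (pendant? G μ)) (Σ-zero n))) (𝟙≤1 (pendant? G μ)))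

  potential-drop : potential G μ ≤ℕ 6 + potential G′ μ′
  potential-drop = go (degree G u) refl
    where
    go : ∀ d → degree G u ≡ d → potential G μ ≤ℕ 6 + potential G′ μ′
    go 0 du≡0 = contradiction (ℕ.≤-trans (adj⇒0<degree G uv) (ℕ.≤-reflexive du≡0)) λ()
    go 1 du≡1 = MinDegree≡1.potential-drop du≡1
    go 2 du≡2 = MinDegree≡2.potential-drop du≡2
    go 3 du≡3 = MinDegree≡3.potential-drop du≡3
    go (suc (suc (suc (suc _)))) du≡ =
      contradiction (ℕ.≤-trans (ℕ.≤-reflexive (sym du≡)) (degree≤3 u)) λ{ (s≤s (s≤s (s≤s ()))) }

-- Accumulating the bound along a run

-- When an arbitrary edge is chosen, all non-isolated vertices have degree at least 3, while `u` has
-- degree at most 3.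
selected-minimal : ∀ {n} {G : Graph n} {u v} → (∀ x → degree G x ≤ℕ 3) → Selects G u v →
  Adj G u v × (∀ x → 0 < degree G x → degree G u ≤ℕ degree G x)
selected-minimal degree≤3 (arbitraryEdge degree≥3 uv) =
  uv , λ x 0<dx → ℕ.≤-trans (degree≤3 _) (degree≥3 x 0<dx)
selected-minimal _ (minDegreeNode _ min uv) = uv , HasMinNonZeroDegree.minimal min

potential-edgeless : ∀ {n} {G : Graph n} {μ} → IsPairing G μ → Edgeless G → potential G μ ≡ 0
potential-edgeless {n} {G} {μ} pairing edgeless = cong₂ _+_
  (trans (Σ-cong weight≡0) (Σ-zero n))
  (𝟙-false (pendant? G μ) λ ((x , dx≡1) , _) → contradiction (trans (sym dx≡1) (degree≡0 x)) λ())
  where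
  degree≡0 : ∀ x → degree G x ≡ 0
  degree≡0 x = isolated⇒degree≡0 G (edgeless x)
  weight≡0 : ∀ x → weight G μ x ≡ 0
  weight≡0 x = trans
    (weight-uncovered G μ (decidable-stable (μ x ≟ x) (λ ≢ → edgeless x _ (IsPairing.adjacent pairing ≢))))
    (cong (2 ⊓_) (degree≡0 x))

-- Each step adds one edge, worth 6, and lowers the potential by at most 6. The list `L` already
-- collected is arbitrary, and the pairing is replaced by its restriction, so that the induction
-- follows the run.
run-bound : ∀ {n} {G H : Graph n} {L M} {μ} → (∀ x → degree G x ≤ℕ 3) → IsPairing G μ →
  Star Step (G , L) (H , M) → Edgeless H → potential G μ + 6 *ℕ length L ≤ℕ 6 *ℕ length M
run-bound {L = L} _ pairing ε edgeless =
  ℕ.≤-reflexive (cong (_+ 6 *ℕ length L) (potential-edgeless pairing edgeless))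
run-bound {G = G} {L = L} {M = M} {μ = μ} degree≤3 pairing (step {u = u} {v} selects ◅ run) edgeless
  with selected-minimal degree≤3 selects
... | uv , minimal = begin
  potential G μ + 6 *ℕ length L            ≤⟨ ℕ.+-monoˡ-≤ (6 *ℕ length L) drop ⟩
  (6 + P′) + 6 *ℕ length L                 ≡⟨ cong (_+ 6 *ℕ length L) (ℕ.+-comm 6 P′) ⟩
  (P′ + 6) + 6 *ℕ length L                 ≡⟨ ℕ.+-assoc P′ 6 _ ⟩
  P′ + (6 + 6 *ℕ length L)                 ≡⟨ cong (_+_ P′) (ℕ.*-suc 6 (length L)) ⟨
  P′ + 6 *ℕ suc (length L)                 ≤⟨ run-bound degree≤3′ (unmatch-pairing μ u v pairing) run edgeless ⟩
  6 *ℕ length M                            ∎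
  where
  open ℕ.≤-Reasoning
  P′ : ℕ
  P′ = potential (removeIncident G u v) (unmatch μ u v)
  drop : potential G μ ≤ℕ 6 + P′
  drop = Greedy.potential-drop G degree≤3 pairing uv minimal
  degree≤3′ : ∀ x → degree (removeIncident G u v) x ≤ℕ 3
  degree≤3′ x = ℕ.≤-trans (degree-removeIncident-≤ G (adj⇒≢ G uv) x) (degree≤3 x)

-- From a list of edges to a pairing

partner : ∀ {n} → List (Fin n × Fin n) → Fin n → Fin n
partner []            x = x
partner ((a , b) ∷ N) x = if does (a ≟ x) then b else if does (b ≟ x) then a else partner N x

partner-avoids : ∀ {n} {a : Fin n} N → All (λ (x , y) → a ≢ x × a ≢ y) N → partner N a ≡ a
partner-avoids [] [] = refl
partner-avoids {a = a} ((x , y) ∷ N) ((a≢x , a≢y) ∷ avoids)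
  rewrite dec-false (x ≟ a) (a≢x ∘ sym) | dec-false (y ≟ a) (a≢y ∘ sym) = partner-avoids N avoids

module PartnerCons {n} {a b : Fin n} {N : List (Fin n × Fin n)}
  (a≢b : a ≢ b) (fresh : All (Disjoint (a , b)) N) where

  private
    μ : Fin n → Fin n
    μ = partner ((a , b) ∷ N)

  tail-fst : partner N a ≡ a
  tail-fst = partner-avoids N (All.map proj₁ fresh)

  tail-snd : partner N b ≡ b
  tail-snd = partner-avoids N (All.map proj₂ fresh)

  partner-fst : μ a ≡ b
  partner-fst rewrite dec-true (a ≟ a) refl = refl

  partner-snd : μ b ≡ a
  partner-snd rewrite dec-false (a ≟ b) a≢b | dec-true (b ≟ b) refl = refl

  partner-neither : ∀ {x} → x ≢ a → x ≢ b → μ x ≡ partner N x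
  partner-neither {x} x≢a x≢b
    rewrite dec-false (a ≟ x) (x≢a ∘ sym) | dec-false (b ≟ x) (x≢b ∘ sym) = refl

matching-tail : ∀ {n} {G : Graph n} {e N} → IsMatching G (e ∷ N) → IsMatching G N
matching-tail record { edges = _ ∷ edges ; disjoint = _ ∷ disjoint } =
  record { edges = edges ; disjoint = disjoint }

partner-pairing : ∀ {n} {G : Graph n} N → IsMatching G N → IsPairing G (partner N)
partner-pairing [] _ = record
  { involutive = λ _ → refl ; adjacent = λ x≢x → contradiction refl x≢x }
partner-pairing {n} {G} ((a , b) ∷ N)
  matching@record { edges = ab ∷ _ ; disjoint = fresh ∷ _ } =
  record { involutive = inv ; adjacent = λ {x} → adj x }
  where
  open IsPairing (partner-pairing N (matching-tail matching))
  open PartnerCons (adj⇒≢ G ab) fresh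
  μ : Fin n → Fin n
  μ = partner ((a , b) ∷ N)
  -- An involution fixing `c` sends no other point to `c`. Hence the tail's partner of `x` avoids
  -- `a` and `b`, and `partner-neither` applies a second time in `inv`.
  partner-≢ : ∀ {x c} → partner N c ≡ c → x ≢ c → partner N x ≢ c
  partner-≢ fixed x≢c px≡c =
    x≢c (trans (sym (involutive _)) (trans (cong (partner N) px≡c) fixed))
  inv : ∀ x → μ (μ x) ≡ x
  inv x with position a b x
  ... | first refl      = trans (cong μ partner-fst) partner-snd
  ... | second refl     = trans (cong μ partner-snd) partner-fst
  ... | neither x≢a x≢b = trans (cong μ (partner-neither x≢a x≢b))
    (trans (partner-neither (partner-≢ tail-fst x≢a) (partner-≢ tail-snd x≢b)) (involutive x))
  adj : ∀ x → μ x ≢ x → Adj G x (μ x)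
  adj x μx≢x with position a b x
  ... | first refl      = subst (Adj G a) (sym partner-fst) ab
  ... | second refl     = subst (Adj G b) (sym partner-snd) (symm G ab)
  ... | neither x≢a x≢b = subst (Adj G x) (sym (partner-neither x≢a x≢b))
    (adjacent (μx≢x ∘ trans (partner-neither x≢a x≢b)))

-- Lower bound for the initial potential

covered : ∀ {n} → (Fin n → Fin n) → Fin n → ℕ
covered μ x = 𝟙 (¬? (μ x ≟ x))

-- The head edge covers two further vertices, since by disjointness the tail fixes both of its ends.
length≤Σ-covered : ∀ {n} {G : Graph n} N → IsMatching G N →
  2 *ℕ length N ≤ℕ Σ[ covered (partner N) ]
length≤Σ-covered [] _ = z≤n
length≤Σ-covered {n} {G} ((a , b) ∷ N)
  matching@record { edges = ab ∷ _ ; disjoint = fresh ∷ _ } = begin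
  2 *ℕ suc (length N)
    ≡⟨ ℕ.*-suc 2 (length N) ⟩
  2 + 2 *ℕ length N
    ≤⟨ ℕ.+-monoʳ-≤ 2 (length≤Σ-covered N (matching-tail matching)) ⟩
  2 + Σ[ covered (partner N) ]
    ≡⟨ cong (_+ Σ[ covered (partner N) ]) (cong₂ _+_ (Σ-δ a) (Σ-δ b)) ⟨
  (Σ[ δ a ] + Σ[ δ b ]) + Σ[ covered (partner N) ]
    ≡⟨ cong (_+ Σ[ covered (partner N) ]) (Σ-+ (δ a) (δ b)) ⟨
  Σ[ (λ x → δ a x + δ b x) ] + Σ[ covered (partner N) ]
    ≡⟨ Σ-+ (λ x → δ a x + δ b x) (covered (partner N)) ⟨
  Σ[ (λ x → (δ a x + δ b x) + covered (partner N) x) ]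
    ≤⟨ Σ-mono-≤ cover ⟩
  Σ[ covered μ ]
    ∎
  where
  open ℕ.≤-Reasoning
  a≢b : a ≢ b
  a≢b = adj⇒≢ G ab
  open PartnerCons a≢b fresh
  μ : Fin n → Fin n
  μ = partner ((a , b) ∷ N)
  covered-fixed : ∀ {x} → partner N x ≡ x → covered (partner N) x ≡ 0
  covered-fixed fixed = 𝟙-false (¬? (_ ≟ _)) (λ ≢ → ≢ fixed)
  cover : ∀ x → (δ a x + δ b x) + covered (partner N) x ≤ℕ covered μ x
  cover x with position a b x
  ... | first refl = begin
    (δ a a + δ b a) + covered (partner N) a
      ≡⟨ cong₂ _+_ (cong₂ _+_ (δ-refl a) (δ-≢ (a≢b ∘ sym))) (covered-fixed tail-fst) ⟩
    1
      ≡⟨ 𝟙-true (¬? (μ a ≟ a)) (λ μa≡a → a≢b (trans (sym μa≡a) partner-fst)) ⟨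
    covered μ a
      ∎
  ... | second refl = begin
    (δ a b + δ b b) + covered (partner N) b
      ≡⟨ cong₂ _+_ (cong₂ _+_ (δ-≢ a≢b) (δ-refl b)) (covered-fixed tail-snd) ⟩
    1
      ≡⟨ 𝟙-true (¬? (μ b ≟ b)) (λ μb≡b → a≢b (trans (sym partner-snd) μb≡b)) ⟨
    covered μ b
      ∎
  ... | neither x≢a x≢b = begin
    (δ a x + δ b x) + covered (partner N) x
      ≡⟨ cong₂ _+_ (cong₂ _+_ (δ-≢ (x≢a ∘ sym)) (δ-≢ (x≢b ∘ sym))) refl ⟩
    covered (partner N) x
      ≡⟨ cong (λ y → 𝟙 (¬? (y ≟ x))) (partner-neither x≢a x≢b) ⟨
    covered μ x
      ∎

-- There are two covered vertices per edge, each of weight 2 whatever its degree; uncovered vertices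
-- and the bonus only help.
4*length≤potential : ∀ {n} (G : Graph n) N → IsMatching G N →
  4 *ℕ length N ≤ℕ potential G (partner N)
4*length≤potential G N matching = begin
  4 *ℕ length N                           ≡⟨ ℕ.*-distribʳ-+ (length N) 2 2 ⟩
  2 *ℕ length N + 2 *ℕ length N           ≤⟨ ℕ.+-mono-≤ bound bound ⟩
  Σ[ covered μ ] + Σ[ covered μ ]         ≡⟨ Σ-+ (covered μ) (covered μ) ⟨
  Σ[ (λ x → covered μ x + covered μ x) ]  ≤⟨ Σ-mono-≤ covered≤weight ⟩
  Σ[ weight G μ ]                         ≤⟨ ℕ.m≤m+n _ _ ⟩
  potential G μ                           ∎
  where
  open ℕ.≤-Reasoning
  μ = partner N
  bound : 2 *ℕ length N ≤ℕ Σ[ covered μ ]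
  bound = length≤Σ-covered N matching
  covered≤weight : ∀ x → covered μ x + covered μ x ≤ℕ weight G μ x
  covered≤weight x with μ x ≟ x
  ... | yes _ = z≤n
  ... | no _  = ℕ.≤-refl

-- Passage to rationals and conclusion

2m≤3k⇒⅔m≤k : ∀ m k → 2 *ℕ m ≤ℕ 3 *ℕ k → (+ k / 1) ≥ ((+ 2 / 3) * (+ m / 1))
-- Unnormalised fractions avoid reduction to lowest terms, so the claim becomes a
-- cross-multiplication. The second argument of `mkℚᵘ` is the denominator minus one.
2m≤3k⇒⅔m≤k m k 2m≤3k = ℚ.toℚᵘ-cancel-≤ (begin
  toℚᵘ ((+ 2 / 3) * (+ m / 1))        ≃⟨ ℚ.toℚᵘ-homo-* (+ 2 / 3) (+ m / 1) ⟩
  toℚᵘ (+ 2 / 3) ℚᵘ.* toℚᵘ (+ m / 1)  ≃⟨ ℚᵘ.*-congˡ {toℚᵘ (+ 2 / 3)} (ℚ.toℚᵘ-fromℚᵘ (mkℚᵘ (+ m) 0)) ⟩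
  mkℚᵘ (+ 2) 2 ℚᵘ.* mkℚᵘ (+ m) 0      ≤⟨ ℚᵘ.*≤* cross ⟩
  mkℚᵘ (+ k) 0                        ≃⟨ ℚ.toℚᵘ-fromℚᵘ (mkℚᵘ (+ k) 0) ⟨
  toℚᵘ (+ k / 1)                      ∎)
  where
  open ℚᵘ.≤-Reasoning
  cross : (+ 2 ℤ.* + m) ℤ.* + 1 ℤ.≤ + k ℤ.* + 3
  cross = subst₂ ℤ._≤_
    (trans (ℤ.pos-* 2 m) (sym (ℤ.*-identityʳ _)))
    (trans (cong +_ (ℕ.*-comm 3 k)) (ℤ.pos-* k 3))
    (ℤ.+≤+ 2m≤3k)

theorem1 : ∀ (n : ℕ) (G : Graph n) →
    (∀ v → degree G v ≤ℕ 3) →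
    ∀ (M* M : List (Fin n × Fin n)) →
    IsMaximumMatching G M* →
    1-2-MinGreedyOutputs G M →
    (+ length M / 1) ≥ ((+ 2 / 3) * (+ length M* / 1))
theorem1 n G degree≤3 M* M maximum (H , run , edgeless) =
  -- The run starts from the empty list, whence the summand `6 *ℕ 0`; halving 4|M*| ≤ 6|M| gives the
  -- required 2|M*| ≤ 3|M|.
  2m≤3k⇒⅔m≤k (length M*) (length M) (ℕ.*-cancelˡ-≤ 2 (begin
    2 *ℕ (2 *ℕ length M*)             ≡⟨ ℕ.*-assoc 2 2 (length M*) ⟨
    4 *ℕ length M*                    ≤⟨ 4*length≤potential G M* isMatching ⟩
    potential G (partner M*)          ≡⟨ ℕ.+-identityʳ _ ⟨
    potential G (partner M*) + 6 *ℕ 0 ≤⟨ run-bound degree≤3 (partner-pairing M* isMatching) run edgeless ⟩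
    6 *ℕ length M                     ≡⟨ ℕ.*-assoc 2 3 (length M) ⟩
    2 *ℕ (3 *ℕ length M)              ∎))
  where
  open ℕ.≤-Reasoning
  open IsMaximumMatching maximum using (isMatching)
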